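{- Let $s$ be a positive integer. Put $d_s(0)=1$ and $d_s(k)=0$ for all integers $k<0$, and for $k\geq 1$ define $d_s(k)=\sum_{j=1}^sd_s(j-1)\,d_s(k-j)$. Then for every $n\geq s$, \[A_{312}(U_{\mathrm{spine}=s,n}^\alpha)=d_s(n-s+1).\]
   Context: For integers $s\ge1$ and $n\ge 0$, the labeled uneven comb $U^\alpha_{\mathrm{spine}=s,n}$ is the poset on $\{1,\dots,n\}$ whose order is generated by the covering relations $i\lessdot i+1$ for $1\le i\le s-1$ with $i+1\le n$, and $i\lessdot i+s$ whenever $i+s\le n$. A linear extension is viewed as a permutation of $[n]$ in which $x$ precedes $y$ whenever $x<y$ in the poset. $A_\tau(P)$ denotes the number of linear extensions of $P$ that avoid the permutation pattern $\tau$. -}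

module Defs where

open import Data.Fin.Base as Fin using (Fin; toℕ)
import Data.Fin.Properties as Fin
import Data.Fin.Induction as Fin
open import Data.Integer.Base as ℤ using (ℤ; +_; -[1+_]; 0ℤ; 1ℤ; ∣_∣; _⊖_)
import Data.Integer.Properties as ℤ
open import Data.List.Base using (List; []; _∷_; [_]; allFin; applyUpTo; cartesianProductWith; filter; length; map)
open import Data.List.Membership.Propositional using (_∈_)
open import Data.List.Membership.Propositional.Properties using (∈-allFin; ∈-cartesianProductWith⁺)
open import Data.List.Relation.Unary.All using ([])
open import Data.List.Relation.Unary.AllPairs using ([]; _∷_)
open import Data.List.Relation.Unary.Any using (here)
open import Data.List.Relation.Unary.Unique.Propositional using (Unique)
import Data.List.Relation.Unary.Unique.Propositional.Properties as Unique
import Data.List.Properties as List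
open import Data.Nat.ListAction using (sum)
open import Data.Nat.Base as ℕ using (ℕ; zero; suc; z≤n; s≤s; NonZero)
import Data.Nat.Properties as ℕ
open import Data.Product using (∃; ∃₂; _×_; _,_; proj₁; proj₂; uncurry)
open import Data.Sum.Base using (_⊎_; inj₁; inj₂)
open import Data.Vec.Base using (Vec; []; _∷_; lookup)
import Data.Vec.Properties as Vec
open import Function.Base using (_∘_)
open import Function.Bundles using (_⇔_; mk⇔; Equivalence)
open import Function.Definitions using (Bijective)
open import Function.Consequences.Propositional using (strictlySurjective⇒surjective; surjective⇒strictlySurjective)
open import Induction.WellFounded using (Acc; acc)
open import Level using (0ℓ; Level)
open import Relation.Binary.Construct.Closure.ReflexiveTransitive using (Star; ε; _◅_)
import Relation.Binary.Construct.Closure.ReflexiveTransitive.Properties as Star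
open import Relation.Binary.Core using (Rel)
import Relation.Binary.Definitions as B
open import Relation.Binary.PropositionalEquality
  using (_≡_; _≢_; refl; sym; trans; cong; cong₂; subst; module ≡-Reasoning)
open import Relation.Binary.Structures using (IsDecPartialOrder)
open import Relation.Nullary.Decidable using (Dec; yes; no; map′; ¬?; _×-dec_; _⊎-dec_; _→-dec_)
open import Relation.Nullary.Negation using (¬_; contradiction)
open import Relation.Unary using (Pred; Decidable)

private
  variable
    k n : ℕ
    p : Level

------------------------------------------------------------------------
-- Words, permutations and patterns

allWords : ∀ k n → List (Vec (Fin n) k)
allWords zero    n = [ [] ]
allWords (suc k) n = cartesianProductWith _∷_ (allFin n) (allWords k n)

∈-allWords : (w : Vec (Fin n) k) → w ∈ allWords k n
∈-allWords []      = here refl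
∈-allWords (x ∷ w) = ∈-cartesianProductWith⁺ _∷_ (∈-allFin x) (∈-allWords w)

allWords-unique : ∀ k n → Unique (allWords k n)
allWords-unique zero    n = [] ∷ []
allWords-unique (suc k) n =
  Unique.cartesianProductWith⁺ _∷_ Vec.∷-injective (Unique.allFin⁺ n) (allWords-unique k n)

anyWord? : ∀ {k} {P : Pred (Vec (Fin n) k) p} → Decidable P → Dec (∃ P)
anyWord? {k = zero}  P? = map′ ([] ,_) (λ { ([] , h) → h }) (P? [])
anyWord? {k = suc k} P? =
  map′ (λ { (x , w , h) → (x ∷ w) , h }) (λ { ((x ∷ w) , h) → x , w , h })
       (Fin.any? λ x → anyWord? λ w → P? (x ∷ w))

-- A word π of length n over Fin n is read as the one-line notation
-- π(1) π(2) … π(n), with the letters 1, …, n shifted down by one.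
IsPermutation : Vec (Fin n) n → Set
IsPermutation π = Bijective _≡_ _≡_ (lookup π)

isPermutation? : Decidable (IsPermutation {n})
isPermutation? π =
  map′ (λ (inj , surj) → (λ {x} {y} → inj x y) , strictlySurjective⇒surjective surj)
       (λ (inj , surj) → (λ x y → inj {x} {y}) , surjective⇒strictlySurjective surj)
       (Fin.all? (λ x → Fin.all? λ y → (lookup π x Fin.≟ lookup π y) →-dec (x Fin.≟ y))
        ×-dec Fin.all? λ y → Fin.any? λ x → lookup π x Fin.≟ y)

Precedes : Vec (Fin n) k → Rel (Fin n) 0ℓ
Precedes π x y = ∃₂ λ i j → i Fin.< j × lookup π i ≡ x × lookup π j ≡ y

precedes? : (π : Vec (Fin n) k) → B.Decidable (Precedes π)
precedes? π x y = Fin.any? λ i → Fin.any? λ j →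
  (i Fin.<? j) ×-dec (lookup π i Fin.≟ x) ×-dec (lookup π j Fin.≟ y)

-- Only the relative order of the letters of τ matters.  The word q lists the
-- positions of π at which τ occurs.
Contains : Vec ℕ k → Vec (Fin n) n → Set
Contains {k} {n} τ π = ∃ λ (q : Vec (Fin n) k) →
  (∀ a b → a Fin.< b → lookup q a Fin.< lookup q b) ×
  (∀ a b → lookup τ a ℕ.< lookup τ b ⇔ lookup π (lookup q a) Fin.< lookup π (lookup q b))

Avoids : Vec ℕ k → Vec (Fin n) n → Set
Avoids τ π = ¬ Contains τ π

contains? : (τ : Vec ℕ k) → Decidable (Contains {n = n} τ)
contains? τ π = anyWord? λ q →
  Fin.all? (λ a → Fin.all? λ b → (a Fin.<? b) →-dec (lookup q a Fin.<? lookup q b))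
  ×-dec
  Fin.all? (λ a → Fin.all? λ b →
    (lookup τ a ℕ.<? lookup τ b) ⇔-dec (lookup π (lookup q a) Fin.<? lookup π (lookup q b)))
  where
  _⇔-dec_ : ∀ {A B : Set} → Dec A → Dec B → Dec (A ⇔ B)
  a? ⇔-dec b? = map′ (uncurry mk⇔) (λ e → Equivalence.to e , Equivalence.from e)
                     ((a? →-dec b?) ×-dec (b? →-dec a?))

------------------------------------------------------------------------
-- Pattern-avoiding linear extensions

IsLinearExtension : Rel (Fin n) 0ℓ → Vec (Fin n) n → Set
IsLinearExtension _≤_ π =
  IsPermutation π × (∀ x y → x ≤ y × x ≢ y → Precedes π x y)

isLinearExtension? : {_≤_ : Rel (Fin n) 0ℓ} → B.Decidable _≤_ →
                     Decidable (IsLinearExtension _≤_)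
isLinearExtension? _≤?_ π =
  isPermutation? π ×-dec
  Fin.all? λ x → Fin.all? λ y → ((x ≤? y) ×-dec ¬? (x Fin.≟ y)) →-dec precedes? π x y

AvoidingExtension : Vec ℕ k → Rel (Fin n) 0ℓ → Vec (Fin n) n → Set
AvoidingExtension τ _≤_ π = IsLinearExtension _≤_ π × Avoids τ π

avoidingExtension? : (τ : Vec ℕ k) {_≤_ : Rel (Fin n) 0ℓ} → B.Decidable _≤_ →
                     Decidable (AvoidingExtension τ _≤_)
avoidingExtension? τ _≤?_ π = isLinearExtension? _≤?_ π ×-dec ¬? (contains? τ π)

A : Vec ℕ k → {_≤_ : Rel (Fin n) 0ℓ} → IsDecPartialOrder _≡_ _≤_ → ℕ
A {n = n} τ P = length (filter (avoidingExtension? τ (IsDecPartialOrder._≤?_ P)) (allWords n n))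

------------------------------------------------------------------------
-- The uneven comb

label : Fin n → ℕ
label x = suc (toℕ x)

module _ (s : ℕ) where

  Cover : Rel (Fin n) 0ℓ
  Cover x y = (label x ℕ.< s × label y ≡ label x ℕ.+ 1) ⊎ label y ≡ label x ℕ.+ s

  CombOrder : ∀ n → Rel (Fin n) 0ℓ
  CombOrder n = Star (Cover {n})

  module _ .{{_ : NonZero s}} where

    cover⇒< : {x y : Fin n} → Cover x y → x Fin.< y
    cover⇒< {x = x} (inj₁ (_ , eq)) = ℕ.s<s⁻¹ (subst (label x ℕ.<_) (sym eq) (ℕ.m<m+n _ (s≤s z≤n)))
    cover⇒< {x = x} (inj₂ eq)       = ℕ.s<s⁻¹ (subst (label x ℕ.<_) (sym eq) (ℕ.m<m+n _ (ℕ.>-nonZero⁻¹ s)))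

    combOrder⇒≤ : {x y : Fin n} → CombOrder n x y → x Fin.≤ y
    combOrder⇒≤ ε        = ℕ.≤-refl
    combOrder⇒≤ (c ◅ cs) = ℕ.≤-trans (ℕ.<⇒≤ (cover⇒< c)) (combOrder⇒≤ cs)

    cover? : B.Decidable (Cover {n})
    cover? x y = ((label x ℕ.<? s) ×-dec (label y ℕ.≟ label x ℕ.+ 1))
                 ⊎-dec (label y ℕ.≟ label x ℕ.+ s)

    combOrder? : B.Decidable (CombOrder n)
    combOrder? {n} x y = go x (Fin.>-wellFounded x)
      where
      go : ∀ x → Acc Fin._>_ x → Dec (CombOrder n x y)
      step : ∀ x → Acc Fin._>_ x → ∀ z → Dec (Cover x z × CombOrder n z y)

      go x a with x Fin.≟ y
      ... | yes refl = yes ε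
      ... | no x≢y   = map′ (λ (_ , c , cs) → c ◅ cs)
                            (λ { ε → contradiction refl x≢y ; (c ◅ cs) → _ , c , cs })
                            (Fin.any? (step x a))

      step x (acc rs) z with cover? x z
      ... | no ¬c = no (¬c ∘ proj₁)
      ... | yes c = map′ (c ,_) proj₂ (go z (rs (cover⇒< c)))

    unevenComb : ∀ n → IsDecPartialOrder _≡_ (CombOrder n)
    unevenComb n = record
      { isPartialOrder = record
        { isPreorder = Star.isPreorder Cover
        ; antisym    = λ p q → Fin.≤-antisym (combOrder⇒≤ p) (combOrder⇒≤ q)
        }
      ; _≟_  = Fin._≟_
      ; _≤?_ = combOrder?
      }

------------------------------------------------------------------------
-- The sequence d

-- The recurrence for d k mentions d (j - 1) also when j > k; those terms carry
-- the factor d (k - j) = 0.  It is therefore not a structural recursion, and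
-- its right-hand side is iterated ∣ k ∣ times instead, which is enough for the
-- recurrence to hold as stated (d-rec).
module _ (s : ℕ) where

  iterate-d : ℕ → ℤ → ℕ
  iterate-d f       -[1+ _ ]  = 0
  iterate-d f       (+ zero)  = 1
  iterate-d zero    (+ suc k) = 0
  iterate-d (suc f) (+ suc k) =
    sum (map (λ j → iterate-d f (+ j ℤ.- 1ℤ) ℕ.* iterate-d f (+ suc k ℤ.- + j)) (applyUpTo suc s))

  d : ℤ → ℕ
  d k = iterate-d ∣ k ∣ k

  private
    sum-cong : ∀ {g h : ℕ → ℕ} → (∀ i → g (suc i) ≡ h (suc i)) →
               sum (map g (applyUpTo suc s)) ≡ sum (map h (applyUpTo suc s))
    sum-cong {g} {h} eq = cong sum (begin
      map g (applyUpTo suc s)  ≡⟨ List.map-applyUpTo suc g s ⟩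
      applyUpTo (g ∘ suc) s    ≡⟨ applyUpTo-cong s eq ⟩
      applyUpTo (h ∘ suc) s    ≡⟨ List.map-applyUpTo suc h s ⟨
      map h (applyUpTo suc s)  ∎)
      where
      open ≡-Reasoning
      applyUpTo-cong : ∀ {g h : ℕ → ℕ} n → (∀ i → g i ≡ h i) → applyUpTo g n ≡ applyUpTo h n
      applyUpTo-cong zero    eq = refl
      applyUpTo-cong (suc n) eq = cong₂ _∷_ (eq 0) (applyUpTo-cong n (eq ∘ suc))

    minus-≤ : ∀ {i k} → i ℕ.≤ k → + suc k ℤ.- + suc i ≡ + (k ℕ.∸ i)
    minus-≤ {i} {k} i≤k = trans (ℤ.[1+m]⊖[1+n]≡m⊖n k i) (ℤ.⊖-≥ i≤k)

    neg-zero : ∀ f {z} → z ℤ.< 0ℤ → iterate-d f z ≡ 0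
    neg-zero f ℤ.-<+ = refl

    minus-> : ∀ {i k} → k ℕ.< i → + suc k ℤ.- + suc i ℤ.< 0ℤ
    minus-> {i} {k} k<i = subst (ℤ._< 0ℤ) (sym (ℤ.[1+m]⊖[1+n]≡m⊖n k i))
      (subst (k ⊖ i ℤ.<_) (ℤ.n⊖n≡0 k) (ℤ.⊖-monoʳ->-< k k<i))

    term-cong : ∀ (g h : ℤ → ℕ) k →
      (∀ n → n ℕ.≤ k → g (+ n) ≡ h (+ n)) →
      (∀ {z} → z ℤ.< 0ℤ → g z ≡ 0) → (∀ {z} → z ℤ.< 0ℤ → h z ≡ 0) →
      ∀ i → g (+ suc i ℤ.- 1ℤ) ℕ.* g (+ suc k ℤ.- + suc i)
          ≡ h (+ suc i ℤ.- 1ℤ) ℕ.* h (+ suc k ℤ.- + suc i)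
    term-cong g h k eq g0 h0 i with i ℕ.≤? k
    ... | yes i≤k rewrite minus-≤ i≤k = cong₂ ℕ._*_ (eq i i≤k) (eq (k ℕ.∸ i) (ℕ.m∸n≤m k i))
    ... | no  i≰k
      rewrite g0 (minus-> (ℕ.≰⇒> i≰k)) | h0 (minus-> (ℕ.≰⇒> i≰k))
            | ℕ.*-zeroʳ (g (+ i)) | ℕ.*-zeroʳ (h (+ i)) = refl

    stable : ∀ f g n → n ℕ.≤ f → n ℕ.≤ g → iterate-d f (+ n) ≡ iterate-d g (+ n)
    stable f       g       zero    _       _       = refl
    stable (suc f) (suc g) (suc k) (s≤s p) (s≤s q) = sum-cong
      (term-cong (iterate-d f) (iterate-d g) k
        (λ n n≤k → stable f g n (ℕ.≤-trans n≤k p) (ℕ.≤-trans n≤k q))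
        (neg-zero f) (neg-zero g))

  d-zero : d 0ℤ ≡ 1
  d-zero = refl

  d-neg : ∀ k → k ℤ.< 0ℤ → d k ≡ 0
  d-neg k = neg-zero ∣ k ∣

  d-rec : ∀ k → k ℤ.≥ 1ℤ →
          d k ≡ sum (map (λ j → d (+ j ℤ.- 1ℤ) ℕ.* d (k ℤ.- + j)) (applyUpTo suc s))
  d-rec (+ suc k) _ = sum-cong
    (term-cong (iterate-d k) d k (λ n n≤k → stable k n n n≤k ℕ.≤-refl)
      (neg-zero k) (λ {z} → d-neg z))
  d-rec (+ zero) (ℤ.+≤+ ())

{-# OPTIONS --safe #-}
module Submission where

-- A 312-avoiding word is u a v with a its least letter, every letter of u being smaller than every
-- letter of v; iterating, 312-avoiding permutations correspond to binary trees whose nodes are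
-- labelled in preorder and read in inorder.  The larger labels that precede a node are those of its
-- left subtree, which are the next consecutive ones: so i comes before i + s iff the left subtree of i
-- has fewer than s nodes, and i comes before i + 1 iff it is empty.  The spine therefore contributes a stem
-- of s - 1 nodes without left child, and the rest is a tree with n - s + 1 nodes all of whose left
-- subtrees have fewer than s nodes; splitting at the root shows that d_s counts these.

open import Defs
open import Data.Integer.Base using (+_; _-_) renaming (_+_ to _+ℤ_)
open import Data.Nat.Base using (ℕ; NonZero; _≤_)
open import Data.Vec.Base using ([]; _∷_)
open import Relation.Binary.PropositionalEquality using (_≡_)

open import Data.Fin.Base as Fin using (Fin; zero; suc; fromℕ<)
import Data.Fin.Properties as Fin
open import Data.Integer.Base using (ℤ; -[1+_]; 1ℤ; _⊖_)
import Data.Integer.Properties as ℤ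
open import Data.List.Base using (List; []; _∷_; _++_; applyUpTo; cartesianProductWith; concat; filter; length; map)
import Data.List.Properties as List
open import Data.List.Membership.Propositional using (_∈_; _∉_)
open import Data.List.Membership.Propositional.Properties
  using (∈-++⁺ˡ; ∈-++⁺ʳ; ∈-++⁻; ∈-∃++; ∈-applyUpTo⁺; ∈-applyUpTo⁻; ∈-cartesianProductWith⁺; ∈-cartesianProductWith⁻;
         ∈-concat⁺′; ∈-concat⁻′; ∈-filter⁺; ∈-filter⁻; ∈-map⁺; ∈-map⁻)
open import Data.List.Membership.Propositional.Properties.WithK using (unique∧set⇒bag)
open import Data.List.Relation.Binary.BagAndSetEquality using (∼bag⇒↭)
open import Data.List.Relation.Binary.Permutation.Propositional.Properties using (↭-length)
open import Data.List.Relation.Unary.All as All using (All; []; _∷_)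
import Data.List.Relation.Unary.All.Properties as All
open import Data.List.Relation.Unary.AllPairs as AllPairs using (AllPairs; []; _∷_)
import Data.List.Relation.Unary.AllPairs.Properties as AllPairs
open import Data.List.Relation.Unary.Any using (here; there)
open import Data.List.Relation.Unary.Unique.Propositional using (Unique)
import Data.List.Relation.Unary.Unique.Propositional.Properties as Unique
open import Data.Nat.Base using (zero; suc; z≤n; s≤s; _+_; _*_; _∸_; _⊔_; _<_; pred; >-nonZero⁻¹; s<s⁻¹)
open import Data.Nat.ListAction using (sum)
open import Data.Nat.Properties
open import Data.Product using (∃; ∃₂; _×_; _,_; proj₁; proj₂)
open import Data.Sum.Base using (_⊎_; inj₁; inj₂)
open import Data.Vec.Base using (Vec; lookup)
open import Function.Base using (_∘_)
open import Function.Bundles using (_⇔_; mk⇔; Equivalence)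
open import Relation.Binary.Construct.Closure.ReflexiveTransitive using (ε; _◅_)
open import Relation.Binary.Core using (Rel)
open import Relation.Binary.Definitions using (tri<; tri≈; tri>)
open import Relation.Binary.PropositionalEquality using (_≢_; refl; sym; trans; cong; cong₂; subst; module ≡-Reasoning)
open import Relation.Nullary.Decidable using (yes; no)
open import Relation.Nullary.Negation using (¬_; contradiction)
open import Relation.Unary using (Decidable)
open import Level using (0ℓ)

-- Pairwise relations on concatenated lists

module _ {X : Set} {R : Rel X 0ℓ} where

  AllPairs-++⁻ : ∀ xs {ys} → AllPairs R (xs ++ ys) →
                 AllPairs R xs × AllPairs R ys × (∀ {x y} → x ∈ xs → y ∈ ys → R x y)
  AllPairs-++⁻ []       ps       = [] , ps , λ ()
  AllPairs-++⁻ (x ∷ xs) (p ∷ ps) with AllPairs-++⁻ xs ps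
  ... | pxs , pys , cross = (All.++⁻ˡ xs p ∷ pxs) , pys , λ where
    (here refl) y∈ → All.lookup (All.++⁻ʳ xs p) y∈
    (there x∈)  y∈ → cross x∈ y∈

  AllPairs-++⁺ : ∀ {xs ys} → AllPairs R xs → AllPairs R ys →
                 (∀ {x y} → x ∈ xs → y ∈ ys → R x y) → AllPairs R (xs ++ ys)
  AllPairs-++⁺ pxs pys cross =
    AllPairs.++⁺ pxs pys (All.tabulate λ x∈ → All.tabulate λ y∈ → cross x∈ y∈)

  AllPairs-tabulate : ∀ {xs} → (∀ {x y} → x ∈ xs → y ∈ xs → R x y) → AllPairs R xs
  AllPairs-tabulate {[]}     f = []
  AllPairs-tabulate {x ∷ xs} f =
    All.tabulate (λ y∈ → f (here refl) (there y∈)) ∷ AllPairs-tabulate (λ x∈ y∈ → f (there x∈) (there y∈))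

-- 312-avoiding words and their splitting at a letter

-- In an occurrence of 312 the head `c` can only play the 3; the pairwise condition on the tail
-- excludes a 1 followed by a 2 for it.
data Avoids312 : List ℕ → Set where
  []  : Avoids312 []
  _∷_ : ∀ {c w} → AllPairs (λ a b → ¬ (a < b × b < c)) w → Avoids312 w → Avoids312 (c ∷ w)

-- If the 3 of an occurrence is in `u`, its 2 cannot be in `v`, whose letters are too large, nor be
-- `a`, since no letter of `u` lies below `a`. So the whole occurrence would lie in `u`.
avoids-++⁺ : ∀ {a u v} → All (a <_) u → (∀ {x y} → x ∈ u → y ∈ v → x < y) →
             Avoids312 u → Avoids312 (a ∷ v) → Avoids312 (u ++ a ∷ v)
avoids-++⁺ {u = []}    _        _   _        av = av
avoids-++⁺ {a} {c ∷ u} {v} (_ ∷ a<u) u<v (pu ∷ au) av =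
  AllPairs-++⁺ pu
    (All.tabulate (λ y∈ (_ , y<c) → <-asym y<c (u<v (here refl) y∈))
      ∷ AllPairs-tabulate (λ _ y∈ (_ , y<c) → <-asym y<c (u<v (here refl) y∈)))
    cross
  ∷ avoids-++⁺ a<u (u<v ∘ there) au av
  where
  cross : ∀ {x y} → x ∈ u → y ∈ a ∷ v → ¬ (x < y × y < c)
  cross x∈ (here refl) (x<a , _) = <-asym x<a (All.lookup a<u x∈)
  cross x∈ (there y∈)  (_ , y<c) = <-asym y<c (u<v (here refl) y∈)

avoids-++⁻ : ∀ {a} u {v} → Avoids312 (u ++ a ∷ v) →
             Avoids312 u × Avoids312 v × (∀ {c y} → c ∈ u → y ∈ v → ¬ (a < y × y < c))
avoids-++⁻ []      (_ ∷ av) = [] , av , λ ()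
avoids-++⁻ (c ∷ u) (p ∷ av) with AllPairs-++⁻ u p | avoids-++⁻ u av
... | pu , (pa ∷ _) , _ | au , av' , cross = (pu ∷ au) , av' , λ where
  (here refl) y∈ → All.lookup pa y∈
  (there c∈)  y∈ → cross c∈ y∈

-- The cut is the maximum of `a` and the successors of the letters of `u`. It turns the comparison
-- of `u` with `v` into a division of the interval of values.
threshold : ∀ {a b} u v → (∀ {x y} → x ∈ u → y ∈ v → x < y) → a ≤ b → All (_< b) u → All (a ≤_) v →
            ∃ λ e → a ≤ e × e ≤ b × All (_< e) u × All (e ≤_) v
threshold []      v u<v a≤b []          a≤v = _ , ≤-refl , a≤b , [] , a≤v
threshold (x ∷ u) v u<v a≤b (x<b ∷ u<b) a≤v with threshold u v (u<v ∘ there) a≤b u<b a≤v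
... | e , a≤e , e≤b , u<e , e≤v =
  e ⊔ suc x , m≤n⇒m≤n⊔o (suc x) a≤e , ⊔-lub e≤b x<b ,
  (m≤n⊔m e (suc x) ∷ All.map (λ y<e → m≤n⇒m≤n⊔o (suc x) y<e) u<e) ,
  All.tabulate (λ y∈ → ⊔-lub (All.lookup e≤v y∈) (u<v (here refl) y∈))

-- Binary trees and their words

data Tree : Set where
  leaf : Tree
  node : Tree → Tree → Tree

size : Tree → ℕ
size leaf       = 0
size (node l r) = suc (size l + size r)

-- The nodes receive the labels a, a + 1, … in preorder and are listed in inorder.  Seen as a forest
-- (left child = first child, right child = next sibling), this is its postorder.
word : ℕ → Tree → List ℕ
word a leaf       = []
word a (node l r) = word (suc a) l ++ a ∷ word (size l + suc a) r

size-node : ∀ a l r → size r + (size l + suc a) ≡ size (node l r) + a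
size-node a l r = begin
  size r + (size l + suc a)  ≡⟨ +-assoc (size r) (size l) (suc a) ⟨
  size r + size l + suc a    ≡⟨ cong (_+ suc a) (+-comm (size r) (size l)) ⟩
  size l + size r + suc a    ≡⟨ +-suc (size l + size r) a ⟩
  size (node l r) + a        ∎
  where open ≡-Reasoning

length-word : ∀ a t → length (word a t) ≡ size t
length-word a leaf       = refl
length-word a (node l r) = begin
  length (word (suc a) l ++ a ∷ word (size l + suc a) r)  ≡⟨ List.length-++ (word (suc a) l) ⟩
  length (word (suc a) l) + suc (length (word (size l + suc a) r))
    ≡⟨ cong₂ (λ i j → i + suc j) (length-word (suc a) l) (length-word (size l + suc a) r) ⟩
  size l + suc (size r)                                   ≡⟨ +-suc (size l) (size r) ⟩
  suc (size l + size r)                                   ∎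
  where open ≡-Reasoning

word-≥ : ∀ a t → All (a ≤_) (word a t)
word-≥ a leaf       = []
word-≥ a (node l r) = All.++⁺ (All.map (≤-trans (n≤1+n a)) (word-≥ (suc a) l))
  (≤-refl ∷ All.map (≤-trans (≤-trans (n≤1+n a) (m≤n+m (suc a) (size l)))) (word-≥ (size l + suc a) r))

∉-word : ∀ a t → a ∉ word (suc a) t
∉-word a t a∈ = 1+n≰n (All.lookup (word-≥ (suc a) t) a∈)

-- The first occurrence of `a` marks the cut on both sides.
++-∷-injective : ∀ {X : Set} {a : X} u u' {v v'} → a ∉ u → a ∉ u' → u ++ a ∷ v ≡ u' ++ a ∷ v' → u ≡ u' × v ≡ v'
++-∷-injective []      []        _   _    eq = refl , List.∷-injectiveʳ eq
++-∷-injective []      (x ∷ u')  _   a∉u' eq = contradiction (here (List.∷-injectiveˡ eq)) a∉u'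
++-∷-injective (x ∷ u) []        a∉u _    eq = contradiction (here (sym (List.∷-injectiveˡ eq))) a∉u
++-∷-injective (x ∷ u) (x' ∷ u') a∉u a∉u' eq
  with refl ← List.∷-injectiveˡ eq | refl , v≡v' ← ++-∷-injective u u' (a∉u ∘ there) (a∉u' ∘ there) (List.∷-injectiveʳ eq)
  = refl , v≡v'

-- The least label `a` marks the root. The left words must be compared first: only after `l` is
-- identified do the right words start from the same label, which depends on `size l`.
word-injective : ∀ a t t' → word a t ≡ word a t' → t ≡ t'
word-injective a leaf leaf eq = refl
word-injective a leaf t'@(node _ _) eq
  with () ← trans (cong length eq) (length-word a t')
word-injective a t@(node _ _) leaf eq
  with () ← trans (cong length (sym eq)) (length-word a t)
word-injective a (node l r) (node l' r') eq
  with eqˡ , eqʳ ← ++-∷-injective (word (suc a) l) (word (suc a) l') (∉-word a l) (∉-word a l') eq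
  with refl ← word-injective (suc a) l l' eqˡ
  = cong (node l) (word-injective (size l + suc a) r r' eqʳ)

-- Avoiding extensions of an interval and trees that fit

module Extensions (_⋖_ : Rel ℕ 0ℓ) where

  -- Only the relation `⋖` is constrained, not its transitive closure. In `ordered` the letter `x`
  -- comes before `y`, so distinctness and the absence of an inverted covering form one pairwise
  -- condition.
  record IsExtension (a b : ℕ) (w : List ℕ) : Set where
    field
      inside  : All (λ x → a ≤ x × x < b) w
      full    : ∀ {x} → a ≤ x → x < b → x ∈ w
      ordered : AllPairs (λ x y → x ≢ y × ¬ y ⋖ x) w
      avoids  : Avoids312 w
  open IsExtension public

  -- The labels strictly between `a` and `size l + suc a` are those of the left subtree, exactly the
  -- larger labels that `word` lists before `a`.
  data Fits : ℕ → Tree → Set where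
    leaf : ∀ {a} → Fits a leaf
    node : ∀ {a l r} → (∀ {x} → a < x → x < size l + suc a → ¬ a ⋖ x) →
           Fits (suc a) l → Fits (size l + suc a) r → Fits a (node l r)

  module _ (⋖⇒< : ∀ {x y} → x ⋖ y → x < y) where

    -- All values in `u` are below `e` and all values in `v` are at least `e`, so the only covering
    -- that could be inverted across the parts is one from `a` to a letter of `u`, which the
    -- hypothesis on `a` excludes.
    extension-join : ∀ {a e b u v} → a < e → e ≤ b → (∀ {x} → a < x → x < e → ¬ a ⋖ x) →
                     IsExtension (suc a) e u → IsExtension e b v → IsExtension a b (u ++ a ∷ v)
    extension-join {a} {e} {b} {u} {v} a<e e≤b a⋖̸ U V = record
      { inside  = All.++⁺ (All.map (λ (a<x , x<e) → <⇒≤ a<x , <-≤-trans x<e e≤b) (inside U))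
                    ((≤-refl , <-≤-trans a<e e≤b) ∷
                     All.map (λ (e≤x , x<b) → ≤-trans (<⇒≤ a<e) e≤x , x<b) (inside V))
      ; full    = full-join
      ; ordered = AllPairs-++⁺ (ordered U)
                    (All.map (λ (e≤y , _) → let a<y = <-≤-trans a<e e≤y in
                        <⇒≢ a<y , λ y⋖a → <-asym a<y (⋖⇒< y⋖a)) (inside V)
                      ∷ ordered V)
                    ordered-join
      ; avoids  = avoids-++⁺ (All.map proj₁ (inside U)) u<v (avoids U)
                    (AllPairs-tabulate (λ _ y∈ (_ , y<a) →
                        <-asym y<a (<-≤-trans a<e (proj₁ (All.lookup (inside V) y∈))))
                      ∷ avoids V)
      }
      where
      u<v : ∀ {x y} → x ∈ u → y ∈ v → x < y
      u<v x∈ y∈ = <-≤-trans (proj₂ (All.lookup (inside U) x∈)) (proj₁ (All.lookup (inside V) y∈))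

      full-join : ∀ {x} → a ≤ x → x < b → x ∈ u ++ a ∷ v
      full-join {x} a≤x x<b with m≤n⇒m<n∨m≡n a≤x | x <? e
      ... | inj₂ refl | _       = ∈-++⁺ʳ u (here refl)
      ... | inj₁ a<x  | yes x<e = ∈-++⁺ˡ (full U a<x x<e)
      ... | inj₁ a<x  | no x≮e  = ∈-++⁺ʳ u (there (full V (≮⇒≥ x≮e) x<b))

      ordered-join : ∀ {x y} → x ∈ u → y ∈ a ∷ v → x ≢ y × ¬ y ⋖ x
      ordered-join x∈ (here refl) with a<x , x<e ← All.lookup (inside U) x∈ = >⇒≢ a<x , a⋖̸ a<x x<e
      ordered-join x∈ (there y∈)  = <⇒≢ (u<v x∈ y∈) , λ y⋖x → <-asym (u<v x∈ y∈) (⋖⇒< y⋖x)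

    fits⇒extension : ∀ {a t} → Fits a t → IsExtension a (size t + a) (word a t)
    fits⇒extension leaf = record
      { inside = [] ; full = λ a≤x x<a → contradiction a≤x (<⇒≱ x<a) ; ordered = [] ; avoids = [] }
    fits⇒extension {a} {node l r} (node a⋖̸ fl fr) =
      subst (λ b → IsExtension a b (word a (node l r))) (size-node a l r)
        (extension-join (m≤n+m (suc a) (size l)) (m≤n+m (size l + suc a) (size r)) a⋖̸
          (fits⇒extension fl) (fits⇒extension fr))

  -- In a 312-avoiding word every letter before the least one is smaller than every letter after it.
  extension-split : ∀ {a b w} → a < b → IsExtension a b w →
    ∃₂ λ u v → ∃ λ e → w ≡ u ++ a ∷ v × a < e × e ≤ b × (∀ {x} → a < x → x < e → ¬ a ⋖ x) ×
    IsExtension (suc a) e u × IsExtension e b v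
  extension-split {a} {b} a<b W
    with u , v , refl ← ∈-∃++ (full W ≤-refl a<b)
    with ou , (a≢v ∷ ov) , cross ← AllPairs-++⁻ u (ordered W)
    with iu , (_ ∷ iv) ← All.++⁻ u (inside W)
    with au , av , avoid-a ← avoids-++⁻ u (avoids W)
    = split
    where
    a<v : ∀ {y} → y ∈ v → a < y
    a<v y∈ = ≤∧≢⇒< (proj₁ (All.lookup iv y∈)) (proj₁ (All.lookup a≢v y∈))
    a<u : ∀ {x} → x ∈ u → a < x
    a<u x∈ = ≤∧≢⇒< (proj₁ (All.lookup iu x∈)) (proj₁ (cross x∈ (here refl)) ∘ sym)
    u<v : ∀ {x y} → x ∈ u → y ∈ v → x < y
    u<v x∈ y∈ = ≤∧≢⇒< (≮⇒≥ λ y<x → avoid-a x∈ y∈ (a<v y∈ , y<x)) (proj₁ (cross x∈ (there y∈)))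

    split : ∃₂ λ u' v' → ∃ λ e → u ++ a ∷ v ≡ u' ++ a ∷ v' × a < e × e ≤ b ×
      (∀ {x} → a < x → x < e → ¬ a ⋖ x) × IsExtension (suc a) e u' × IsExtension e b v'
    -- Here `a<b` is read as `suc a ≤ b`: the cut is sought from `suc a` on, so `e` exceeds `a` even
    -- for empty `u`.
    split with threshold u v u<v a<b (All.map proj₂ iu) (All.tabulate a<v)
    ... | e , a<e , e≤b , u<e , e≤v =
      u , v , e , refl , a<e , e≤b , (λ a<x x<e → proj₂ (cross (full-u a<x x<e) (here refl))) ,
      record { inside  = All.tabulate (λ x∈ → a<u x∈ , All.lookup u<e x∈)
             ; full    = full-u ; ordered = ou ; avoids = au } ,
      record { inside  = All.tabulate (λ y∈ → All.lookup e≤v y∈ , proj₂ (All.lookup iv y∈))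
             ; full    = full-v ; ordered = ov ; avoids = av }
      where
      full-u : ∀ {x} → a < x → x < e → x ∈ u
      full-u a<x x<e with ∈-++⁻ u (full W (<⇒≤ a<x) (<-≤-trans x<e e≤b))
      ... | inj₁ x∈          = x∈
      ... | inj₂ (here refl) = contradiction a<x (<-irrefl refl)
      ... | inj₂ (there x∈)  = contradiction x<e (≤⇒≯ (All.lookup e≤v x∈))

      full-v : ∀ {x} → e ≤ x → x < b → x ∈ v
      full-v e≤x x<b with ∈-++⁻ u (full W (≤-trans (<⇒≤ a<e) e≤x) x<b)
      ... | inj₁ x∈          = contradiction e≤x (<⇒≱ (All.lookup u<e x∈))
      ... | inj₂ (here refl) = contradiction e≤x (<⇒≱ a<e)
      ... | inj₂ (there x∈)  = x∈

  -- The least letter becomes the root and the two pieces become the subtrees. The pieces are not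
  -- structurally smaller, so `go` recurses on a bound `N` for the length of the interval.
  extension⇒fits : ∀ {a b w} → a ≤ b → IsExtension a b w →
                   ∃ λ t → size t + a ≡ b × Fits a t × word a t ≡ w
  extension⇒fits {a} {b} = go b (m≤m+n b a)
    where
    go : ∀ N {a b w} → b ≤ N + a → a ≤ b → IsExtension a b w →
         ∃ λ t → size t + a ≡ b × Fits a t × word a t ≡ w
    go N {a} b≤N+a a≤b W with m≤n⇒m<n∨m≡n a≤b
    go N {w = []}    b≤N+a a≤b W | inj₂ refl = leaf , refl , leaf , refl
    go N {w = _ ∷ _} b≤N+a a≤b W | inj₂ refl with (a≤x , x<a) ∷ _ ← inside W = contradiction a≤x (<⇒≱ x<a)
    go zero    b≤a   _ W | inj₁ a<b = contradiction b≤a (<⇒≱ a<b)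
    go (suc N) {a} {b} b≤N+a _ W | inj₁ a<b
      with u , v , e , refl , a<e , e≤b , a⋖̸ , U , V ← extension-split a<b W
      -- Both pieces lie in the interval from `suc a` to `b`, whose length is at most `N`.
      with b≤N+1+a ← subst (b ≤_) (sym (+-suc N a)) b≤N+a
      with l , refl , fl , refl ← go N (≤-trans e≤b b≤N+1+a) a<e U
      with r , refl , fr , refl ← go N (≤-trans b≤N+1+a (+-monoʳ-≤ N a<e)) e≤b V
      = node l r , sym (size-node a l r) , node a⋖̸ fl fr , refl

-- Lengths of lists and integer differences

module _ {X Y Z : Set} where

  length-cartesianProductWith : ∀ (f : X → Y → Z) xs ys →
    length (cartesianProductWith f xs ys) ≡ length xs * length ys
  length-cartesianProductWith f []       ys = refl
  length-cartesianProductWith f (x ∷ xs) ys = trans (List.length-++ (map (f x) ys))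
    (cong₂ _+_ (List.length-map (f x) ys) (length-cartesianProductWith f xs ys))

length-concat-map : ∀ {X Y : Set} {f : X → List Y} {g : X → ℕ} → (∀ x → length (f x) ≡ g x) →
                    ∀ xs → length (concat (map f xs)) ≡ sum (map g xs)
length-concat-map         eq []       = refl
length-concat-map {f = f} eq (x ∷ xs) =
  trans (List.length-++ (f x)) (cong₂ _+_ (eq x) (length-concat-map eq xs))

-- The images in `Z` are duplicate-free with the same members, hence permutations of each other. No
-- bijection between `X` and `Y` has to be written down.
length-≡ : ∀ {X Y Z : Set} {f : X → Z} {g : Y → Z} {xs ys} →
           (∀ {x x'} → f x ≡ f x' → x ≡ x') → (∀ {y y'} → g y ≡ g y' → y ≡ y') → Unique xs → Unique ys →
           (∀ {x} → x ∈ xs → ∃ λ y → y ∈ ys × f x ≡ g y) → (∀ {y} → y ∈ ys → ∃ λ x → x ∈ xs × f x ≡ g y) →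
           length xs ≡ length ys
length-≡ {f = f} {g} {xs} {ys} f-inj g-inj xs! ys! to from = begin
  length xs          ≡⟨ List.length-map f xs ⟨
  length (map f xs)  ≡⟨ ↭-length (∼bag⇒↭ (unique∧set⇒bag (Unique.map⁺ f-inj xs!) (Unique.map⁺ g-inj ys!)
                          (mk⇔ to′ from′))) ⟩
  length (map g ys)  ≡⟨ List.length-map g ys ⟩
  length ys          ∎
  where
  open ≡-Reasoning

  to′ : ∀ {z} → z ∈ map f xs → z ∈ map g ys
  to′ z∈ with x , x∈ , refl ← ∈-map⁻ f z∈ with y , y∈ , eq ← to x∈ = subst (_∈ map g ys) (sym eq) (∈-map⁺ g y∈)

  from′ : ∀ {z} → z ∈ map g ys → z ∈ map f xs
  from′ z∈ with y , y∈ , refl ← ∈-map⁻ g z∈ with x , x∈ , eq ← from y∈ = subst (_∈ map f xs) eq (∈-map⁺ f x∈)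

⊖≡+⇒≡+ : ∀ m n {k} → m ⊖ n ≡ + k → m ≡ n + k
⊖≡+⇒≡+ m       zero    refl = refl
⊖≡+⇒≡+ (suc m) (suc n) eq   = cong suc (⊖≡+⇒≡+ m n (trans (sym (ℤ.[1+m]⊖[1+n]≡m⊖n m n)) eq))

1+m+n⊖1+m≡n : ∀ m n → suc (m + n) ⊖ suc m ≡ + n
1+m+n⊖1+m≡n m n = begin
  suc (m + n) ⊖ suc m  ≡⟨ ℤ.⊖-≥ (s≤s (m≤m+n m n)) ⟩
  + (m + n ∸ m)        ≡⟨ cong +_ (m+n∸m≡n m n) ⟩
  + n                  ∎
  where open ≡-Reasoning

-- Trees with small left subtrees, counted by `d`

module BoundedTrees (s : ℕ) where

  data Bounded : Tree → Set where
    leaf : Bounded leaf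
    node : ∀ {l r} → size l < s → Bounded l → Bounded r → Bounded (node l r)

  -- The clauses follow those of `iterate-d`, fuel included, with concatenations for sums and
  -- cartesian products for products. In block `j` the left subtree has `j - 1` nodes.
  trees : ℕ → ℤ → List Tree
  nodes : ℕ → ℕ → ℕ → List Tree

  trees f       -[1+ _ ]  = []
  trees f       (+ zero)  = leaf ∷ []
  trees zero    (+ suc k) = []
  trees (suc f) (+ suc k) = concat (map (nodes f k) (applyUpTo suc s))

  nodes f k j = cartesianProductWith node (trees f (+ j - 1ℤ)) (trees f (+ suc k - + j))

  length-trees : ∀ f z → length (trees f z) ≡ iterate-d s f z
  length-trees f       -[1+ _ ]  = refl
  length-trees f       (+ zero)  = refl
  length-trees zero    (+ suc k) = refl
  length-trees (suc f) (+ suc k) = length-concat-map (λ j →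
    trans (length-cartesianProductWith node (trees f (+ j - 1ℤ)) (trees f (+ suc k - + j)))
          (cong₂ _*_ (length-trees f (+ j - 1ℤ)) (length-trees f (+ suc k - + j))))
    (applyUpTo suc s)

  ∈-trees⁻ : ∀ f z {t} → t ∈ trees f z → z ≡ + size t × Bounded t
  ∈-trees⁻ f       (+ zero)  (here refl) = refl , leaf
  ∈-trees⁻ (suc f) (+ suc k) t∈
    with _ , t∈block , block∈ ← ∈-concat⁻′ (map (nodes f k) (applyUpTo suc s)) t∈
    with j , j∈ , refl ← ∈-map⁻ (nodes f k) block∈
    with i , i<s , refl ← ∈-applyUpTo⁻ suc j∈
    with l , r , l∈ , r∈ , refl ← ∈-cartesianProductWith⁻ node (trees f (+ i)) _ t∈block
    -- Matching replaces `i` by `size l`, so `i<s` becomes the bound on the left subtree.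
    with refl , bl ← ∈-trees⁻ f (+ i) l∈
    with eq , br ← ∈-trees⁻ f (+ suc k - + suc i) r∈
    = cong +_ (⊖≡+⇒≡+ (suc k) (suc i) eq) , node i<s bl br

  -- Fuel `size t` suffices because both subtrees of a node are smaller than the tree; the tree is
  -- found in block `suc (size l)`.
  ∈-trees⁺ : ∀ f {t} → size t ≤ f → Bounded t → t ∈ trees f (+ size t)
  ∈-trees⁺ f       _         leaf = here refl
  ∈-trees⁺ (suc f) (s≤s ≤f) (node {l} {r} l<s bl br) = ∈-concat⁺′
    (∈-cartesianProductWith⁺ node
      (∈-trees⁺ f (≤-trans (m≤m+n (size l) (size r)) ≤f) bl)
      (subst (λ z → r ∈ trees f z) (sym (1+m+n⊖1+m≡n (size l) (size r)))
        (∈-trees⁺ f (≤-trans (m≤n+m (size r) (size l)) ≤f) br)))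
    (∈-map⁺ (nodes f _) (∈-applyUpTo⁺ suc l<s))

  trees-unique : ∀ f z → Unique (trees f z)
  trees-unique f       -[1+ _ ]  = []
  trees-unique f       (+ zero)  = [] ∷ []
  trees-unique zero    (+ suc k) = []
  trees-unique (suc f) (+ suc k) = Unique.concat⁺
    (All.map⁺ (All.applyUpTo⁺₂ suc s λ i → Unique.cartesianProductWith⁺ node (λ { refl → refl , refl })
      (trees-unique f (+ i)) (trees-unique f (+ suc k - + suc i))))
    -- Distinct blocks are disjoint: the size of the left subtree at the root recovers the index of
    -- the block.
    (AllPairs.map⁺ (AllPairs.applyUpTo⁺₁ suc s λ i<j _ (t∈ , t∈′) →
      <⇒≢ i<j (ℤ.+-injective (trans (left-size _ t∈) (sym (left-size _ t∈′))))))
    where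
    left : Tree → Tree
    -- An arbitrary value: the blocks contain no `leaf`.
    left leaf       = leaf
    left (node l r) = l

    left-size : ∀ i {t} → t ∈ nodes f k (suc i) → + i ≡ + size (left t)
    left-size i t∈ with l , r , l∈ , _ , refl ← ∈-cartesianProductWith⁻ node (trees f (+ i)) _ t∈ =
      proj₁ (∈-trees⁻ f (+ i) l∈)

-- Stems and the trees that fit the comb

-- From `a` on, the word of a stem lists `k` consecutive labels in increasing order and continues
-- with the word of `t` from `k + a`.
stem : ℕ → Tree → Tree
stem zero    t = t
stem (suc k) t = node leaf (stem k t)

size-stem : ∀ k t → size (stem k t) ≡ k + size t
size-stem zero    t = refl
size-stem (suc k) t = cong suc (size-stem k t)

stem-injective : ∀ k {t t'} → stem k t ≡ stem k t' → t ≡ t'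
stem-injective zero    eq = eq
stem-injective (suc k) eq = stem-injective k (node-injectiveʳ eq)
  where
  node-injectiveʳ : ∀ {l r l' r'} → node l r ≡ node l' r' → r ≡ r'
  node-injectiveʳ refl = refl

module Comb (s : ℕ) .{{_ : NonZero s}} where
  open BoundedTrees s

  infix 4 _⋖_
  -- At labels this unfolds to `Cover s`; the bound by `n` enters only through the interval of an
  -- `IsExtension`.
  _⋖_ : Rel ℕ 0ℓ
  p ⋖ q = (p < s × q ≡ p + 1) ⊎ q ≡ p + s

  open Extensions _⋖_

  0<s : 0 < s
  0<s = >-nonZero⁻¹ s

  ⋖⇒< : ∀ {p q} → p ⋖ q → p < q
  ⋖⇒< {p} (inj₁ (_ , refl)) = m<m+n p (s≤s z≤n)
  ⋖⇒< {p} (inj₂ refl)       = m<m+n p 0<s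

  -- From label `s` on only the covering `a ⋖ a + s` remains, and the labels of the left subtree end
  -- at `size l + a`, which is below `a + s`.
  bounded⇒fits : ∀ {a t} → s ≤ a → Bounded t → Fits a t
  bounded⇒fits s≤a leaf = leaf
  bounded⇒fits {a} s≤a (node {l} {r} l<s bl br) =
    node a⋖̸ (bounded⇒fits (m≤n⇒m≤1+n s≤a) bl) (bounded⇒fits (m≤n⇒m≤o+n (size l) (m≤n⇒m≤1+n s≤a)) br)
    where
    a⋖̸ : ∀ {x} → a < x → x < size l + suc a → ¬ a ⋖ x
    a⋖̸ _ _   (inj₁ (a<s , _)) = <⇒≱ a<s s≤a
    a⋖̸ _ x<e (inj₂ refl)      = <⇒≱ x<e (begin
      size l + suc a  ≡⟨ +-suc (size l) a ⟩
      suc (size l) + a ≤⟨ +-monoˡ-≤ a l<s ⟩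
      s + a            ≡⟨ +-comm s a ⟩
      a + s            ∎)
      where open ≤-Reasoning

  -- If `s ≤ size l`, the label `a + s` would belong to the left subtree of `a`.
  fits⇒bounded : ∀ {a t} → Fits a t → s ≤ a → Bounded t
  fits⇒bounded leaf s≤a = leaf
  fits⇒bounded {a} (node {l = l} a⋖̸ fl fr) s≤a =
    node (≰⇒> λ s≤l → a⋖̸ (m<m+n a 0<s) (begin-strict
           a + s           ≡⟨ +-comm a s ⟩
           s + a           ≤⟨ +-monoˡ-≤ a s≤l ⟩
           size l + a      <⟨ +-monoʳ-< (size l) (n<1+n a) ⟩
           size l + suc a  ∎) (inj₂ refl))
         (fits⇒bounded fl (m≤n⇒m≤1+n s≤a)) (fits⇒bounded fr (m≤n⇒m≤o+n (size l) (m≤n⇒m≤1+n s≤a)))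
    where open ≤-Reasoning

  -- The left subtree of a stem node is empty, so its range of forbidden labels is empty too;
  -- `k + a ≡ s` makes the labels of `t` start at `s`.
  fits-stem⁺ : ∀ k {a t} → k + a ≡ s → Bounded t → Fits a (stem k t)
  fits-stem⁺ zero    refl bt = bounded⇒fits ≤-refl bt
  fits-stem⁺ (suc k) {a} eq bt =
    node (λ a<x x<e → contradiction x<e (≤⇒≯ a<x)) leaf (fits-stem⁺ k (trans (+-suc k a) eq) bt)

  -- For a < s the covering a ⋖ a + 1 leaves no room for a left child below the node labelled a.
  fits-stem⁻ : ∀ k {a t} → k + a ≡ s → k ≤ size t → Fits a t → ∃ λ t' → t ≡ stem k t' × Bounded t'
  fits-stem⁻ zero refl _ ft = _ , refl , fits⇒bounded ft ≤-refl
  fits-stem⁻ (suc k) {a} eq (s≤s k≤) (node {l = leaf} _ _ fr)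
    with t' , refl , bt ← fits-stem⁻ k (trans (+-suc k a) eq) k≤ fr = t' , refl , bt
  fits-stem⁻ (suc k) {a} eq _ (node {l = node l₁ l₂} a⋖̸ _ _) =
    contradiction (inj₁ (subst (a <_) eq (s≤s (m≤n+m a k)) , +-comm 1 a))
      (a⋖̸ ≤-refl (s≤s (m≤n+m (suc a) _)))

-- Words over `Fin n` as lists of labels

module _ {n : ℕ} where

  labels : ∀ {k} → Vec (Fin n) k → List ℕ
  labels []      = []
  labels (x ∷ π) = label x ∷ labels π

  label-injective : ∀ {x y : Fin n} → label x ≡ label y → x ≡ y
  label-injective = Fin.toℕ-injective ∘ suc-injective

  labels-injective : ∀ {k} {π ρ : Vec (Fin n) k} → labels π ≡ labels ρ → π ≡ ρ
  labels-injective {π = []}    {[]}    eq = refl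
  labels-injective {π = x ∷ π} {y ∷ ρ} eq =
    cong₂ _∷_ (label-injective (List.∷-injectiveˡ eq)) (labels-injective (List.∷-injectiveʳ eq))

  labels-surjective : ∀ k {w} → length w ≡ k → All (λ x → 1 ≤ x × x < suc n) w →
                      ∃ λ (π : Vec (Fin n) k) → labels π ≡ w
  labels-surjective zero    {[]}        _  _                  = [] , refl
  labels-surjective (suc k) {suc x ∷ w} eq ((_ , s≤s x<n) ∷ ps)
    with π , refl ← labels-surjective k (suc-injective eq) ps
    = fromℕ< x<n ∷ π , cong (λ y → suc y ∷ labels π) (Fin.toℕ-fromℕ< x<n)

  labels-inside : ∀ {k} (π : Vec (Fin n) k) → All (λ x → 1 ≤ x × x < suc n) (labels π)
  labels-inside []      = []
  labels-inside (x ∷ π) = (s≤s z≤n , s≤s (Fin.toℕ<n x)) ∷ labels-inside π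

  ∈-labels⁺ : ∀ {k} (π : Vec (Fin n) k) i → label (lookup π i) ∈ labels π
  ∈-labels⁺ (x ∷ π) zero    = here refl
  ∈-labels⁺ (x ∷ π) (suc i) = there (∈-labels⁺ π i)

  ∈-labels⁻ : ∀ {k} (π : Vec (Fin n) k) {x} → x ∈ labels π → ∃ λ i → x ≡ label (lookup π i)
  ∈-labels⁻ (x ∷ π) (here refl) = zero , refl
  ∈-labels⁻ (x ∷ π) (there x∈) with i , eq ← ∈-labels⁻ π x∈ = suc i , eq

  module _ {R : Rel ℕ 0ℓ} where

    AllPairs-labels⁺ : ∀ {k} (π : Vec (Fin n) k) →
      (∀ {i j} → i Fin.< j → R (label (lookup π i)) (label (lookup π j))) → AllPairs R (labels π)
    AllPairs-labels⁺ []      h = []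
    AllPairs-labels⁺ (x ∷ π) h =
      All.tabulate (λ y∈ → let j , eq = ∈-labels⁻ π y∈ in subst (R (label x)) (sym eq) (h {zero} {suc j} (s≤s z≤n)))
      ∷ AllPairs-labels⁺ π (h ∘ s≤s)

    AllPairs-labels⁻ : ∀ {k} (π : Vec (Fin n) k) → AllPairs R (labels π) →
      ∀ i j → i Fin.< j → R (label (lookup π i)) (label (lookup π j))
    AllPairs-labels⁻ (x ∷ π) (p ∷ _)  zero    (suc j) _       = All.lookup p (∈-labels⁺ π j)
    AllPairs-labels⁻ (x ∷ π) (_ ∷ ps) (suc i) (suc j) (s≤s i<j) = AllPairs-labels⁻ π ps i j i<j

  Occurs312 : ∀ {k} → Vec (Fin n) k → Fin k → Fin k → Fin k → Set
  Occurs312 π i j k = lookup π j Fin.< lookup π k × lookup π k Fin.< lookup π i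

  avoids-labels⁺ : ∀ {k} (π : Vec (Fin n) k) →
    (∀ {i j k} → i Fin.< j → j Fin.< k → ¬ Occurs312 π i j k) → Avoids312 (labels π)
  avoids-labels⁺ []      h = []
  avoids-labels⁺ (x ∷ π) h =
    AllPairs-labels⁺ π (λ {i} {j} i<j (p , q) → h {zero} {suc i} {suc j} (s≤s z≤n) (s≤s i<j) (s<s⁻¹ p , s<s⁻¹ q))
    ∷ avoids-labels⁺ π (λ i<j j<k → h (s≤s i<j) (s≤s j<k))

  avoids-labels⁻ : ∀ {k} (π : Vec (Fin n) k) → Avoids312 (labels π) →
    ∀ i j k → i Fin.< j → j Fin.< k → ¬ Occurs312 π i j k
  avoids-labels⁻ (x ∷ π) (p ∷ _)  zero    (suc j) (suc k) _         (s≤s j<k) (q , r) =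
    AllPairs-labels⁻ π p j k j<k (s≤s q , s≤s r)
  avoids-labels⁻ (x ∷ π) (_ ∷ av) (suc i) (suc j) (suc k) (s≤s i<j) (s≤s j<k) =
    avoids-labels⁻ π av i j k i<j j<k

-- Occurrences of the pattern 312

τ₃₁₂ : Vec ℕ 3
τ₃₁₂ = 3 ∷ 1 ∷ 2 ∷ []

contains⁺ : ∀ {n} (π : Vec (Fin n) n) {i j k} → i Fin.< j → j Fin.< k → Occurs312 π i j k → Contains τ₃₁₂ π
contains⁺ π {i} {j} {k} i<j j<k (πj<πk , πk<πi) = q , increasing , same-order
  where
  q : Vec (Fin _) 3
  q = i ∷ j ∷ k ∷ []

  increasing : ∀ a b → a Fin.< b → lookup q a Fin.< lookup q b
  increasing zero          (suc zero)       _ = i<j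
  increasing zero          (suc (suc zero)) _ = <-trans i<j j<k
  increasing (suc zero)    (suc (suc zero)) _ = j<k
  increasing (suc zero)    (suc zero)       (s≤s ())
  increasing (suc (suc zero)) (suc zero)    (s≤s ())
  increasing (suc (suc zero)) (suc (suc zero)) (s≤s (s≤s ()))

  πj<πi : lookup π j Fin.< lookup π i
  πj<πi = <-trans πj<πk πk<πi

  both : ∀ {P Q : Set} → P → Q → P ⇔ Q
  both p q = mk⇔ (λ _ → q) (λ _ → p)

  neither : ∀ {P Q : Set} → ¬ P → ¬ Q → P ⇔ Q
  neither ¬p ¬q = mk⇔ (λ p → contradiction p ¬p) (λ q → contradiction q ¬q)

  same-order : ∀ a b → lookup τ₃₁₂ a < lookup τ₃₁₂ b ⇔ lookup π (lookup q a) Fin.< lookup π (lookup q b)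
  same-order zero             zero             = neither (<-irrefl refl) (<-irrefl refl)
  same-order zero             (suc zero)       = neither (λ { (s≤s ()) }) (<-asym πj<πi)
  same-order zero             (suc (suc zero)) = neither (λ { (s≤s (s≤s ())) }) (<-asym πk<πi)
  same-order (suc zero)       zero             = both (s≤s (s≤s z≤n)) πj<πi
  same-order (suc zero)       (suc zero)       = neither (<-irrefl refl) (<-irrefl refl)
  same-order (suc zero)       (suc (suc zero)) = both (s≤s (s≤s z≤n)) πj<πk
  same-order (suc (suc zero)) zero             = both (s≤s (s≤s (s≤s z≤n))) πk<πi
  same-order (suc (suc zero)) (suc zero)       = neither (λ { (s≤s ()) }) (<-asym πj<πk)
  same-order (suc (suc zero)) (suc (suc zero)) = neither (<-irrefl refl) (<-irrefl refl)

contains⁻ : ∀ {n} (π : Vec (Fin n) n) → Contains τ₃₁₂ π →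
            ∃ λ i → ∃₂ λ j k → i Fin.< j × j Fin.< k × Occurs312 π i j k
contains⁻ π (q , increasing , same-order) =
  _ , _ , _ , increasing zero (suc zero) (s≤s z≤n) , increasing (suc zero) (suc (suc zero)) (s≤s (s≤s z≤n)) ,
  -- The pattern has 1 at index 1, 2 at index 2 and 3 at index 0, so the comparisons 1 < 2 and 2 < 3
  -- are the ones transferred.
  Equivalence.to (same-order (suc zero) (suc (suc zero))) (s≤s (s≤s z≤n)) ,
  Equivalence.to (same-order (suc (suc zero)) zero) (s≤s (s≤s (s≤s z≤n)))

-- Linear extensions of the comb as extensions of an interval

module _ (s : ℕ) .{{_ : NonZero s}} {n : ℕ} where
  open BoundedTrees s
  open Comb s
  open Extensions _⋖_

  avoiding⇒extension : ∀ (π : Vec (Fin n) n) → AvoidingExtension τ₃₁₂ (CombOrder s n) π →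
                       IsExtension 1 (suc n) (labels π)
  avoiding⇒extension π (((inj , surj) , linear) , avoid) = record
    { inside  = labels-inside π
    ; full    = full-labels
    ; ordered = AllPairs-labels⁺ π (λ {i} {j} i<j → (λ eq → Fin.<⇒≢ i<j (inj (label-injective eq))) , uncovered i<j)
    ; avoids  = avoids-labels⁺ π (λ i<j j<k occ → avoid (contains⁺ π i<j j<k occ))
    }
    where
    full-labels : ∀ {x} → 1 ≤ x → x < suc n → x ∈ labels π
    full-labels {suc x} _ (s≤s x<n) with i , eq ← surj (fromℕ< x<n) =
      subst (_∈ labels π) (trans (cong label (eq refl)) (cong suc (Fin.toℕ-fromℕ< x<n))) (∈-labels⁺ π i)

    uncovered : ∀ {i j} → i Fin.< j → ¬ label (lookup π j) ⋖ label (lookup π i)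
    uncovered {i} {j} i<j c
      -- The covering puts the letter at `j` before the letter at `i`; by injectivity these are the
      -- positions `i'` and `j'`, against `i < j`.
      with i' , j' , i'<j' , eqᵢ , eqⱼ ← linear _ _ ((c ◅ ε) , Fin.<⇒≢ (cover⇒< s c))
      with refl ← inj {i'} {j} eqᵢ | refl ← inj {j'} {i} eqⱼ
      = <-asym i<j i'<j'

  extension⇒avoiding : ∀ (π : Vec (Fin n) n) → IsExtension 1 (suc n) (labels π) →
                       AvoidingExtension τ₃₁₂ (CombOrder s n) π
  extension⇒avoiding π W = ((inj , surj) , λ x y (x≤y , x≢y) → linear x≤y x≢y) , avoid
    where
    pair : ∀ i j → i Fin.< j → label (lookup π i) ≢ label (lookup π j) × ¬ label (lookup π j) ⋖ label (lookup π i)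
    pair = AllPairs-labels⁻ π (ordered W)

    inj : ∀ {i j} → lookup π i ≡ lookup π j → i ≡ j
    inj {i} {j} eq with Fin.<-cmp i j
    ... | tri< i<j _ _ = contradiction (cong label eq) (proj₁ (pair i j i<j))
    ... | tri≈ _ i≡j _ = i≡j
    ... | tri> _ _ j<i = contradiction (cong label (sym eq)) (proj₁ (pair j i j<i))

    position : ∀ x → ∃ λ i → lookup π i ≡ x
    position x with i , eq ← ∈-labels⁻ π (full W (s≤s z≤n) (s≤s (Fin.toℕ<n x))) = i , sym (label-injective eq)

    surj : ∀ x → ∃ λ i → ∀ {j} → j ≡ i → lookup π j ≡ x
    surj x with i , eq ← position x = i , λ { refl → eq }

    cover⇒precedes : ∀ {x y} → Cover s x y → Precedes π x y
    cover⇒precedes {x} {y} c with i , refl ← position x | j , refl ← position y with Fin.<-cmp i j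
    ... | tri< i<j _ _  = i , j , i<j , refl , refl
    ... | tri≈ _ refl _ = contradiction (⋖⇒< c) (<-irrefl refl)
    ... | tri> _ _ j<i  = contradiction c (proj₂ (pair j i j<i))

    -- Induction along a chain of coverings. If its first step already reaches `y`, that step alone
    -- gives the precedence.
    linear : ∀ {x y} → CombOrder s n x y → x ≢ y → Precedes π x y
    linear ε x≢y = contradiction refl x≢y
    linear {y = y} (_◅_ {j = z} c cs) _ with z Fin.≟ y
    ... | yes refl = cover⇒precedes c
    ... | no z≢y
      with i , j , i<j , eqˣ , eqᶻ ← cover⇒precedes c
      with j' , k , j'<k , eqᶻ′ , eqʸ ← linear cs z≢y
      -- The letter `z` has a single position, so the two precedences compose.
      with refl ← inj {j} {j'} (trans eqᶻ (sym eqᶻ′))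
      = i , k , <-trans i<j j'<k , eqˣ , eqʸ

    avoid : Avoids τ₃₁₂ π
    avoid occ with i , j , k , i<j , j<k , o ← contains⁻ π occ = avoids-labels⁻ π (avoids W) i j k i<j j<k o

-- Counting the avoiding extensions

module _ (s : ℕ) .{{_ : NonZero s}} where
  open BoundedTrees s
  open Comb s
  open Extensions _⋖_

  -- The stem takes the labels below `s`, so the labels of `t` start at `s`.
  stemWord : Tree → List ℕ
  stemWord t = word 1 (stem (pred s) t)

  stemWord-injective : ∀ {t t'} → stemWord t ≡ stemWord t' → t ≡ t'
  stemWord-injective = stem-injective (pred s) ∘ word-injective 1 _ _

  pred[s]+1≡s : pred s + 1 ≡ s
  pred[s]+1≡s = trans (+-comm (pred s) 1) (suc-pred s)

  extension⇒stemWord : ∀ {m w} → IsExtension 1 (suc (pred s + m)) w →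
                       ∃ λ t → size t ≡ m × Bounded t × stemWord t ≡ w
  extension⇒stemWord {m} W
    with t , size-t , ft , refl ← extension⇒fits (s≤s z≤n) W
    with size-t ← suc-injective (trans (+-comm 1 (size t)) size-t)
    with t' , refl , bt ← fits-stem⁻ (pred s) pred[s]+1≡s (subst (pred s ≤_) (sym size-t) (m≤m+n (pred s) m)) ft
    = t' , +-cancelˡ-≡ (pred s) _ _ (trans (sym (size-stem (pred s) t')) size-t) , bt , refl

  stemWord-extension : ∀ {t} → Bounded t → IsExtension 1 (suc (pred s + size t)) (stemWord t)
  stemWord-extension {t} bt = subst (λ b → IsExtension 1 b (stemWord t))
    (trans (+-comm _ 1) (cong suc (size-stem (pred s) t)))
    (fits⇒extension ⋖⇒< (fits-stem⁺ (pred s) pred[s]+1≡s bt))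

  length-stemWord : ∀ t → length (stemWord t) ≡ pred s + size t
  length-stemWord t = trans (length-word 1 (stem (pred s) t)) (size-stem (pred s) t)

  -- Avoiding extensions under `labels` and bounded trees under `stemWord` have the same image among
  -- lists of naturals. Fuel `m` at index `+ m` is the fuel used by `d`.
  A₃₁₂≡d : ∀ m → A τ₃₁₂ (unevenComb s (pred s + m)) ≡ d s (+ m)
  A₃₁₂≡d m = trans
    (length-≡ labels-injective stemWord-injective
      (Unique.filter⁺ avoiding? (allWords-unique n n)) (trees-unique m (+ m)) to from)
    (length-trees m (+ m))
    where
    n : ℕ
    n = pred s + m

    avoiding? : Decidable (AvoidingExtension τ₃₁₂ (CombOrder s n))
    avoiding? = avoidingExtension? τ₃₁₂ (combOrder? s)

    to : ∀ {π} → π ∈ filter avoiding? (allWords n n) → ∃ λ t → t ∈ trees m (+ m) × labels π ≡ stemWord t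
    to {π} π∈ =
      let t , size-t , bt , eq = extension⇒stemWord
            (avoiding⇒extension s π (proj₂ (∈-filter⁻ avoiding? {xs = allWords n n} π∈)))
      in t , subst (λ k → t ∈ trees m (+ k)) size-t (∈-trees⁺ m (≤-reflexive size-t) bt) , sym eq

    from : ∀ {t} → t ∈ trees m (+ m) → ∃ λ π → π ∈ filter avoiding? (allWords n n) × labels π ≡ stemWord t
    from {t} t∈ =
      let size-t , bt = ∈-trees⁻ m (+ m) t∈
          size≡n      = cong (λ k → pred s + k) (sym (ℤ.+-injective size-t))
          W           = subst (λ b → IsExtension 1 (suc b) (stemWord t)) size≡n (stemWord-extension bt)
          π , eq      = labels-surjective n (trans (length-stemWord t) size≡n) (inside W)
      in π , ∈-filter⁺ avoiding? (∈-allWords π)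
               (extension⇒avoiding s π (subst (IsExtension 1 (suc n)) (sym eq) W)) , eq

theorem2 : (s : ℕ) .{{_ : NonZero s}} (n : ℕ) → s ≤ n →
    A (3 ∷ 1 ∷ 2 ∷ []) (unevenComb s n) ≡ d s (((+ n) - (+ s)) +ℤ (+ 1))
theorem2 s n s≤n = begin
  A τ₃₁₂ (unevenComb s n)                   ≡⟨ cong (λ k → A τ₃₁₂ (unevenComb s k)) n≡ ⟩
  A τ₃₁₂ (unevenComb s (pred s + (n ∸ s + 1)))  ≡⟨ A₃₁₂≡d s (n ∸ s + 1) ⟩
  -- By `s ≤ n` the integer difference is nonnegative and agrees with `n ∸ s`.
  d s (+ (n ∸ s) +ℤ + 1)                    ≡⟨ cong (λ z → d s (z +ℤ + 1)) (trans (ℤ.m-n≡m⊖n n s) (ℤ.⊖-≥ s≤n)) ⟨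
  d s (+ n - + s +ℤ + 1)                    ∎
  where
  open ≡-Reasoning

  n≡ : n ≡ pred s + (n ∸ s + 1)
  n≡ = begin
    n                       ≡⟨ m+[n∸m]≡n s≤n ⟨
    s + (n ∸ s)             ≡⟨ cong (_+ (n ∸ s)) (pred[s]+1≡s s) ⟨
    pred s + 1 + (n ∸ s)    ≡⟨ +-assoc (pred s) 1 (n ∸ s) ⟩
    pred s + (1 + (n ∸ s))  ≡⟨ cong (λ k → pred s + k) (+-comm 1 (n ∸ s)) ⟩
    pred s + (n ∸ s + 1)    ∎
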